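{- Let $v,w\in S_n$ be such that $v\le w$ and $w$ is $k$-Grassmannian. Let $\mathbf{x_w}$ be a reduced word for $x_w$, let $\mathbf w$ be a reduced word for $w$, and let $\mathbf{x_w}\mathbf w=(s_{i_1},s_{i_2},\dots)$ be their concatenation. Then for every $x_wv$-subword $\mathbf u=(u_1,u_2,\dots)$ of $\mathbf{x_w}\mathbf{w}$, we have $u_j=s_{i_j}$ for $1\le j\le\ell(x_w)$.
   Context: Let $n\ge2$, $0\le k\le n$. $\tilde S_n$ is the group of bijections $f:\mathbb{Z}\to\mathbb{Z}$ with $f(i+n)=f(i)+n$, with products read left to right, $(fg)(a)=g(f(a))$. $\tilde S_n^{(k)}$ is the subset with $\frac1n\sum_{i=1}^n(f(i)-i)=k$. Length: $\ell(f)=\#\{(a,b):1\le a\le n,\ b\in\mathbb{Z},\ a<b,\ f(a)>f(b)\}$. $s_i$ ($0\le i\le n-1$) exchanges $i+mn$ and $i+1+mn$ for all $m$ and fixes all other integers. $\Lambda(i)=i+1$. $S_n=\langle s_1,\dots,s_{n-1}\rangle\subset\tilde S_n$ via periodic extension; $\le$ is Bruhat order on $S_n$. A word is a finite sequence $\mathbf g=(s_{i_1},\dots,s_{i_m})$ of elements of $\{s_0,\dots,s_{n-1}\}$. A reduced word for $f\in\tilde S_n^{(k)}$ is a reduced word for $\Lambda^{ -k}f\in\tilde S_n^{(0)}$, i.e. $s_{i_1}\cdots s_{i_m}=\Lambda^{ -k}f$ with $m=\ell(f)$ (for $w\in S_n$ take $k=0$, the usual notion). A subword of $\mathbf g$ is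 a sequence $\mathbf u=(u_1,\dots,u_m)$ with $u_j\in\{s_{i_j},e\}$; for $f\in\tilde S_n^{(k)}$ it is an $f$-subword if $u_1\cdots u_m=\Lambda^{ -k}f$. A permutation $w\in S_n$ is $k$-Grassmannian if $w(1)<\dots<w(k)$ and $w(k+1)<\dots<w(n)$. $\tau_{k,n}\in\tilde S_n^{(k)}$ is given by $\tau_{k,n}(i)=i+n$ for $1\le i\le k$ and $\tau_{k,n}(i)=i$ for $k+1\le i\le n$; and $x_w:=w^{ -1}\tau_{k,n}\in\tilde S_n^{(k)}$. -}

module Defs where

open import Algebra.Bundles using (AbelianGroup)
import Algebra.Properties.CommutativeMonoid.Sum
import Algebra.Properties.Group
open import Data.Bool.Base using (if_then_else_)
open import Data.Empty using (⊥)
open import Data.Fin.Base as Fin using (Fin; toℕ; fromℕ<)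
open import Data.Fin.Permutation as Perm
  using (Permutation′; permutation; transpose; _∘ₚ_; _⟨$⟩ʳ_; _⟨$⟩ˡ_)
open import Data.Fin.Properties using (toℕ-fromℕ<; toℕ<n; toℕ-injective)
open import Data.Integer.Base
  using (ℤ; +_; -[1+_]; _+_; _*_; _-_; -_; _⊖_; ∣_∣; _≤_; _<_; 0ℤ; 1ℤ; -1ℤ)
open import Data.Integer.DivMod using (_/ℕ_; _%ℕ_; n%ℕd<d; a≡a%ℕn+[a/ℕn]*n)
open import Data.Integer.Divisibility.Signed
  using (_∣_; divides; _∣?_; ∣⇒∣ᵤ; ∣-refl; ∣m∣n⇒∣m+n; ∣m∣n⇒∣m-n; ∣m+n∣n⇒∣m)
import Data.Integer.Properties as ℤ
open import Data.Integer.Tactic.RingSolver using (solve-∀)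
open import Data.Nat.Base as ℕ using (ℕ; NonZero; NonTrivial; nonTrivial⇒nonZero; _<ᵇ_)
import Data.Nat.Divisibility as ℕ
import Data.Nat.Properties as ℕ
open import Data.Product.Base using (Σ-syntax; ∃₂; _×_; _,_)
open import Data.Sum.Base using (_⊎_)
open import Data.Vec.Base using (Vec; foldr; map)
open import Data.Vec.Relation.Binary.Pointwise.Inductive using (Pointwise)
open import Function.Bundles using (_↔_; Inverse; mk↔ₛ′)
open import Function.Construct.Composition using (_↔-∘_)
open import Function.Construct.Identity using (↔-id)
open import Function.Construct.Symmetry using (↔-sym)
open import Relation.Binary.Construct.Closure.ReflexiveTransitive using (Star)
open import Relation.Binary.PropositionalEquality
open import Relation.Nullary using (yes; no; ¬_; contradiction)

open Algebra.Properties.CommutativeMonoid.Sum ℤ.+-0-commutativeMonoid public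
  using (sum; sum-permute; sum-cong-≗; ∑-distrib-+; sum-replicate-zero)

open Algebra.Properties.Group (AbelianGroup.group ℤ.+-0-abelianGroup)
  using () renaming (∙-cancelˡ to +-cancelˡ; ∙-cancelʳ to +-cancelʳ)

open ≡-Reasoning

private variable
  n k m : ℕ

record AffPerm (n : ℕ) : Set where
  field
    bijection : ℤ ↔ ℤ
  open Inverse bijection public using (to; from)
  field
    periodic : ∀ a → to (a + + n) ≡ to a + + n

  to-from : ∀ a → to (from a) ≡ a
  to-from = Inverse.strictlyInverseˡ bijection

  from-to : ∀ a → from (to a) ≡ a
  from-to = Inverse.strictlyInverseʳ bijection

open AffPerm public

infix 4 _≈_
infixl 7 _·_
infix 8 _⁻¹

_≈_ : AffPerm n → AffPerm n → Set
f ≈ g = ∀ a → to f a ≡ to g a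

e : AffPerm n
e = record { bijection = ↔-id ℤ ; periodic = λ _ → refl }

-- Products are read left to right: to (f · g) a = to g (to f a).
_·_ : AffPerm n → AffPerm n → AffPerm n
f · g = record
  { bijection = bijection g ↔-∘ bijection f
  ; periodic  = λ a → trans (cong (to g) (periodic f a)) (periodic g (to f a))
  }

_⁻¹ : AffPerm n → AffPerm n
_⁻¹ {n} f = record
  { bijection = ↔-sym (bijection f)
  ; periodic  = λ a → begin
      from f (a + + n)                 ≡⟨ cong (λ b → from f (b + + n)) (to-from f a) ⟨
      from f (to f (from f a) + + n)   ≡⟨ cong (from f) (periodic f (from f a)) ⟨
      from f (to f (from f a + + n))   ≡⟨ from-to f _ ⟩
      from f a + + n                   ∎
  }

-- Λ^ z is the z-th power of Λ : i ↦ i + 1.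
Λ^ : ℤ → AffPerm n
Λ^ {n} z = record
  { bijection = mk↔ₛ′ (_+ z) (_- z) (λ a → p a z) (λ a → q a z)
  ; periodic  = λ a → r a (+ n) z
  }
  where
  p : ∀ a z → a - z + z ≡ a
  p = solve-∀
  q : ∀ a z → a + z - z ≡ a
  q = solve-∀
  r : ∀ a b z → a + b + z ≡ a + z + b
  r = solve-∀

Inversion : AffPerm n → Set
Inversion {n} f =
  Σ[ (a , b) ∈ ℤ × ℤ ] 1ℤ ≤ a × a ≤ + n × a < b × to f b < to f a

-- ℓ(f) = m, as a statement about cardinality.
HasLength : AffPerm n → ℕ → Set
HasLength f m = Fin m ↔ Inversion f

-- Fin n indexes {1, …, n}.
pos : Fin n → ℤ
pos i = + ℕ.suc (toℕ i)

-- n times the average of f(i) − i over 1 ≤ i ≤ n.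
displacement : AffPerm n → ℤ
displacement {n} f = sum {n} (λ i → to f (pos i) - pos i)

record AffPermᵏ (n k : ℕ) : Set where
  field
    perm    : AffPerm n
    average : displacement perm ≡ + n * + k

open AffPermᵏ public

periodic-* : ∀ (f : AffPerm n) a q → to f (a + q * + n) ≡ to f a + q * + n
periodic-* {n} f a (+ q) = go q
  where
  step : ∀ a q b → a + (1ℤ + q) * b ≡ a + q * b + b
  step = solve-∀
  go : ∀ q → to f (a + + q * + n) ≡ to f a + + q * + n
  go ℕ.zero    = trans (cong (to f) (ℤ.+-identityʳ a)) (sym (ℤ.+-identityʳ _))
  go (ℕ.suc q) = begin
    to f (a + + ℕ.suc q * + n)    ≡⟨ cong (to f) (step a (+ q) (+ n)) ⟩
    to f (a + + q * + n + + n)    ≡⟨ periodic f _ ⟩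
    to f (a + + q * + n) + + n    ≡⟨ cong (_+ + n) (go q) ⟩
    to f a + + q * + n + + n      ≡⟨ step (to f a) (+ q) (+ n) ⟨
    to f a + + ℕ.suc q * + n      ∎
periodic-* {n} f a -[1+ q ] = begin
  to f (a + -[1+ q ] * + n)                                ≡⟨ i (to f (a + -[1+ q ] * + n)) (+ ℕ.suc q) (+ n) ⟩
  to f (a + -[1+ q ] * + n) + + ℕ.suc q * + n + -[1+ q ] * + n
    ≡⟨ cong (_+ -[1+ q ] * + n) (periodic-* f _ (+ ℕ.suc q)) ⟨
  to f (a + -[1+ q ] * + n + + ℕ.suc q * + n) + -[1+ q ] * + n
    ≡⟨ cong (λ b → to f b + -[1+ q ] * + n) (j a (+ ℕ.suc q) (+ n)) ⟩
  to f a + -[1+ q ] * + n                                  ∎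
  where
  i : ∀ a q b → a ≡ a + q * b + (- q) * b
  i = solve-∀
  j : ∀ a q b → a + (- q) * b + q * b ≡ a
  j = solve-∀

module _ {n : ℕ} .{{nt : NonTrivial n}} where

  private instance
    nonZero : NonZero n
    nonZero = nonTrivial⇒nonZero n

  -- Every integer is uniquely pos r + q * n.
  residue : ℤ → Fin n
  residue a = fromℕ< (n%ℕd<d (a - 1ℤ) n)

  quotient : ℤ → ℤ
  quotient a = (a - 1ℤ) /ℕ n

  decompose : ∀ a → a ≡ pos (residue a) + quotient a * + n
  decompose a = begin
    a                                                     ≡⟨ i a ⟩
    1ℤ + (a - 1ℤ)                                         ≡⟨ cong (_+_ 1ℤ) (a≡a%ℕn+[a/ℕn]*n (a - 1ℤ) n) ⟩
    1ℤ + (+ ((a - 1ℤ) %ℕ n) + quotient a * + n)           ≡⟨ ℤ.+-assoc 1ℤ (+ ((a - 1ℤ) %ℕ n)) (quotient a * + n) ⟨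
    + ℕ.suc ((a - 1ℤ) %ℕ n) + quotient a * + n
      ≡⟨ cong (λ r → + ℕ.suc r + quotient a * + n) (toℕ-fromℕ< (n%ℕd<d (a - 1ℤ) n)) ⟨
    pos (residue a) + quotient a * + n                    ∎
    where
    i : ∀ a → a ≡ 1ℤ + (a - 1ℤ)
    i = solve-∀

  private
    residue-unique : ∀ (r r′ : Fin n) q q′ → pos r + q * + n ≡ pos r′ + q′ * + n → r ≡ r′
    residue-unique r r′ q q′ eq = toℕ-injective (ℤ.+-injective (ℤ.i-j≡0⇒i≡j (+ toℕ r) (+ toℕ r′)
      (trans (ℤ.m-n≡m⊖n (toℕ r) (toℕ r′)) (ℤ.∣i∣≡0⇒i≡0 (small ∣ toℕ r ⊖ toℕ r′ ∣
        (ℕ.≤-<-trans (ℤ.∣m⊝n∣≤m⊔n (toℕ r) (toℕ r′)) (ℕ.⊔-lub (toℕ<n r) (toℕ<n r′)))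
        (subst (n ℕ.∣_) abs (∣⇒∣ᵤ (divides (q′ - q) diff))))))))
      where
      small : ∀ d → d ℕ.< n → n ℕ.∣ d → d ≡ 0
      small ℕ.zero    _   _   = refl
      small (ℕ.suc d) d<n n∣d = contradiction n∣d (ℕ.>⇒∤ d<n)
      i : ∀ x y a b → x - y ≡ (x + a) - (y + b) + (b - a)
      i = solve-∀
      j : ∀ z a b m → z - z + (b * m - a * m) ≡ (b - a) * m
      j = solve-∀
      diff : pos r - pos r′ ≡ (q′ - q) * + n
      diff = begin
        pos r - pos r′
          ≡⟨ i (pos r) (pos r′) (q * + n) (q′ * + n) ⟩
        (pos r + q * + n) - (pos r′ + q′ * + n) + (q′ * + n - q * + n)
          ≡⟨ cong (λ z → z - (pos r′ + q′ * + n) + (q′ * + n - q * + n)) eq ⟩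
        (pos r′ + q′ * + n) - (pos r′ + q′ * + n) + (q′ * + n - q * + n)
          ≡⟨ j (pos r′ + q′ * + n) q q′ (+ n) ⟩
        (q′ - q) * + n ∎
      abs : ∣ pos r - pos r′ ∣ ≡ ∣ toℕ r ⊖ toℕ r′ ∣
      abs = cong ∣_∣ (ℤ.[1+m]⊖[1+n]≡m⊖n (toℕ r) (toℕ r′))

  residue-pos : ∀ r q → residue (pos r + q * + n) ≡ r
  residue-pos r q = residue-unique (residue a) r (quotient a) q (sym (decompose a))
    where a = pos r + q * + n

  quotient-pos : ∀ r q → quotient (pos r + q * + n) ≡ q
  quotient-pos r q = ℤ.*-cancelʳ-≡ _ _ (+ n) (+-cancelˡ (pos r) _ _ (begin
    pos r + quotient a * + n               ≡⟨ cong (λ t → pos t + quotient a * + n) (residue-pos r q) ⟨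
    pos (residue a) + quotient a * + n     ≡⟨ decompose a ⟨
    pos r + q * + n                        ∎))
    where a = pos r + q * + n

  private
    shift : ∀ a b q m → a + b * m + q * m ≡ a + (b + q) * m
    shift = solve-∀

  decompose-* : ∀ a q → a + q * + n ≡ pos (residue a) + (quotient a + q) * + n
  decompose-* a q = trans (cong (_+ q * + n) (decompose a)) (shift (pos (residue a)) (quotient a) q (+ n))

  residue-* : ∀ a q → residue (a + q * + n) ≡ residue a
  residue-* a q = trans (cong residue (decompose-* a q)) (residue-pos (residue a) (quotient a + q))

  quotient-* : ∀ a q → quotient (a + q * + n) ≡ quotient a + q
  quotient-* a q = trans (cong quotient (decompose-* a q)) (quotient-pos (residue a) (quotient a + q))

  -- The affine permutation i ↦ π(i) + c(i) n for 1 ≤ i ≤ n.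
  extend : Permutation′ n → (Fin n → ℤ) → AffPerm n
  extend π c = record
    { bijection = mk↔ₛ′ f g fg gf
    ; periodic  = per
    }
    where
    F G : Fin n → ℤ → ℤ
    F r q = pos (π ⟨$⟩ʳ r) + (q + c r) * + n
    G r q = pos (π ⟨$⟩ˡ r) + (q - c (π ⟨$⟩ˡ r)) * + n
    f g : ℤ → ℤ
    f a = F (residue a) (quotient a)
    g a = G (residue a) (quotient a)
    i : ∀ a b → a - b + b ≡ a
    i = solve-∀
    j : ∀ a b → a + b - b ≡ a
    j = solve-∀
    fg : ∀ a → f (g a) ≡ a
    fg a = begin
      f (g a)                            ≡⟨ cong₂ F (residue-pos r′ (q - c r′)) (quotient-pos r′ (q - c r′)) ⟩
      F r′ (q - c r′)                    ≡⟨ cong₂ (λ r q → pos r + q * + n) (Perm.inverseʳ π) (i q (c r′)) ⟩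
      pos (residue a) + q * + n          ≡⟨ decompose a ⟨
      a                                  ∎
      where
      r′ = π ⟨$⟩ˡ residue a
      q  = quotient a
    gf : ∀ a → g (f a) ≡ a
    gf a = begin
      g (f a)                            ≡⟨ cong₂ G (residue-pos (π ⟨$⟩ʳ r) (q + c r)) (quotient-pos (π ⟨$⟩ʳ r) (q + c r)) ⟩
      G (π ⟨$⟩ʳ r) (q + c r)             ≡⟨ cong (λ t → pos t + (q + c r - c t) * + n) (Perm.inverseˡ π) ⟩
      pos r + (q + c r - c r) * + n      ≡⟨ cong (λ z → pos r + z * + n) (j q (c r)) ⟩
      pos r + q * + n                    ≡⟨ decompose a ⟨
      a                                  ∎
      where
      r = residue a
      q = quotient a
    l : ∀ x q c m → x + (q + 1ℤ + c) * m ≡ x + (q + c) * m + m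
    l = solve-∀
    per : ∀ a → f (a + + n) ≡ f a + + n
    per a = begin
      f (a + + n)         ≡⟨ cong (λ b → f (a + b)) (ℤ.*-identityˡ (+ n)) ⟨
      f (a + 1ℤ * + n)    ≡⟨ cong₂ (λ r q → pos (π ⟨$⟩ʳ r) + (q + c r) * + n) (residue-* a 1ℤ) (quotient-* a 1ℤ) ⟩
      pos (π ⟨$⟩ʳ residue a) + (quotient a + 1ℤ + c (residue a)) * + n
                          ≡⟨ l (pos (π ⟨$⟩ʳ residue a)) (quotient a) (c (residue a)) (+ n) ⟩
      f a + + n           ∎

  extend-pos : ∀ π c i → to (extend π c) (pos i) ≡ pos (π ⟨$⟩ʳ i) + c i * + n
  extend-pos π c i = begin
    to (extend π c) (pos i)
      ≡⟨ cong (to (extend π c)) (ℤ.+-identityʳ (pos i)) ⟨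
    to (extend π c) (pos i + 0ℤ * + n)
      ≡⟨ cong₂ (λ r q → pos (π ⟨$⟩ʳ r) + (q + c r) * + n) (residue-pos i 0ℤ) (quotient-pos i 0ℤ) ⟩
    pos (π ⟨$⟩ʳ i) + (0ℤ + c i) * + n
      ≡⟨ cong (λ z → pos (π ⟨$⟩ʳ i) + z * + n) (ℤ.+-identityˡ (c i)) ⟩
    pos (π ⟨$⟩ʳ i) + c i * + n ∎

  -- The inclusion of Sₙ, realised as permutations of {1, …, n}.
  embed : Permutation′ n → AffPerm n
  embed π = extend π (λ _ → 0ℤ)

  -- 1 on {1, …, k} and 0 on {k + 1, …, n}.
  χ : ℕ → Fin n → ℤ
  χ k i = if toℕ i <ᵇ k then 1ℤ else 0ℤ

  τ : ℕ → AffPerm n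
  τ k = extend Perm.id (χ k)

  residuePermutation : AffPerm n → Permutation′ n
  residuePermutation f = permutation
    (λ i → residue (to f (pos i))) (λ i → residue (from f (pos i)))
    (inv (f ⁻¹)) (inv f)
    where
    i : ∀ x q m → x ≡ x + q * m + (- q) * m
    i = solve-∀
    inv : ∀ (f : AffPerm n) i → residue (from f (pos (residue (to f (pos i))))) ≡ i
    inv f r = begin
      residue (from f (pos (residue b)))
        ≡⟨ cong (λ c → residue (from f c)) (i (pos (residue b)) (quotient b) (+ n)) ⟩
      residue (from f (pos (residue b) + quotient b * + n + (- quotient b) * + n))
        ≡⟨ cong (λ c → residue (from f (c + (- quotient b) * + n))) (decompose b) ⟨
      residue (from f (b + (- quotient b) * + n))
        ≡⟨ cong residue (periodic-* (f ⁻¹) b (- quotient b)) ⟩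
      residue (from f b + (- quotient b) * + n)
        ≡⟨ residue-* (from f b) (- quotient b) ⟩
      residue (from f b)
        ≡⟨ cong residue (from-to f (pos r)) ⟩
      residue (pos r)
        ≡⟨ cong residue (ℤ.+-identityʳ (pos r)) ⟨
      residue (pos r + 0ℤ * + n)
        ≡⟨ residue-pos r 0ℤ ⟩
      r ∎
      where b = to f (pos r)

  private
    sum-cong : ∀ {t u : Fin n → ℤ} → (∀ i → t i ≡ u i) → sum {n} t ≡ sum {n} u
    sum-cong {t} {u} t≗u = sum-cong-≗ {n} {t} {u} t≗u

  displacement-· : ∀ (f g : AffPerm n) → displacement (f · g) ≡ displacement f + displacement g
  displacement-· f g = begin
    sum {n} (λ i → to g (to f (pos i)) - pos i)
      ≡⟨ sum-cong split ⟩
    sum {n} (λ i → (to f (pos i) - pos i) + d (ρ ⟨$⟩ʳ i))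
      ≡⟨ ∑-distrib-+ {n} (λ i → to f (pos i) - pos i) (λ i → d (ρ ⟨$⟩ʳ i)) ⟩
    displacement f + sum {n} (λ i → d (ρ ⟨$⟩ʳ i))
      ≡⟨ cong (_+_ (displacement f)) (sum-permute d ρ) ⟨
    displacement f + displacement g ∎
    where
    ρ = residuePermutation f
    d : Fin n → ℤ
    d i = to g (pos i) - pos i
    i : ∀ x y z q m → x + q * m - z ≡ (y + q * m - z) + (x - y)
    i = solve-∀
    split : ∀ r → to g (to f (pos r)) - pos r ≡ (to f (pos r) - pos r) + d (ρ ⟨$⟩ʳ r)
    split r = begin
      to g b - pos r
        ≡⟨ cong (λ c → to g c - pos r) (decompose b) ⟩
      to g (pos (residue b) + quotient b * + n) - pos r
        ≡⟨ cong (_- pos r) (periodic-* g (pos (residue b)) (quotient b)) ⟩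
      to g (pos (residue b)) + quotient b * + n - pos r
        ≡⟨ i (to g (pos (residue b))) (pos (residue b)) (pos r) (quotient b) (+ n) ⟩
      (pos (residue b) + quotient b * + n - pos r) + d (residue b)
        ≡⟨ cong (λ c → (c - pos r) + d (residue b)) (decompose b) ⟨
      (b - pos r) + d (residue b) ∎
      where b = to f (pos r)

  displacement-⁻¹ : ∀ (f : AffPerm n) → displacement (f ⁻¹) ≡ - displacement f
  displacement-⁻¹ f = begin
    displacement (f ⁻¹)
      ≡⟨ i (displacement f) (displacement (f ⁻¹)) ⟩
    - displacement f + (displacement f + displacement (f ⁻¹))
      ≡⟨ cong (_+_ (- displacement f)) (displacement-· f (f ⁻¹)) ⟨
    - displacement f + displacement (f · f ⁻¹)
      ≡⟨ cong (_+_ (- displacement f)) (sum-cong (λ r →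
           trans (cong (_- pos r) (from-to f (pos r))) (ℤ.+-inverseʳ (pos r)))) ⟩
    - displacement f + sum {n} (λ _ → 0ℤ)
      ≡⟨ cong (_+_ (- displacement f)) (sum-replicate-zero n) ⟩
    - displacement f + 0ℤ
      ≡⟨ ℤ.+-identityʳ _ ⟩
    - displacement f ∎
    where
    i : ∀ a b → b ≡ - a + (a + b)
    i = solve-∀

  displacement-embed : ∀ π → displacement (embed π) ≡ 0ℤ
  displacement-embed π = +-cancelʳ (sum {n} pos) _ _ (begin
    displacement (embed π) + sum {n} pos
      ≡⟨ ∑-distrib-+ {n} (λ i → to (embed π) (pos i) - pos i) pos ⟨
    sum {n} (λ i → to (embed π) (pos i) - pos i + pos i)
      ≡⟨ sum-cong (λ i → trans (j (to (embed π) (pos i)) (pos i))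
           (trans (extend-pos π (λ _ → 0ℤ) i) (ℤ.+-identityʳ _))) ⟩
    sum {n} (λ i → pos (π ⟨$⟩ʳ i))
      ≡⟨ sum-permute pos π ⟨
    sum {n} pos
      ≡⟨ ℤ.+-identityˡ _ ⟨
    0ℤ + sum {n} pos ∎)
    where
    j : ∀ a b → a - b + b ≡ a
    j = solve-∀

  displacement-τ : k ℕ.≤ n → displacement (τ k) ≡ + n * + k
  displacement-τ {k} k≤n = trans
    (sum-cong (λ i → trans (cong (_- pos i) (extend-pos Perm.id (χ k) i)) (j (pos i) (χ k i * + n))))
    (count n k k≤n)
    where
    j : ∀ a b → a + b - a ≡ b
    j = solve-∀
    step : ∀ b c → 1ℤ * b + b * c ≡ b * (1ℤ + c)
    step = solve-∀
    count : ∀ m k → k ℕ.≤ m → sum {m} (λ i → (if toℕ i <ᵇ k then 1ℤ else 0ℤ) * + n) ≡ + n * + k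
    count m         ℕ.zero    _             = trans (sum-replicate-zero m) (sym (ℤ.*-zeroʳ (+ n)))
    count (ℕ.suc m) (ℕ.suc k) (ℕ.s≤s k≤m) = trans
      (cong (_+_ (1ℤ * + n)) (count m k k≤m)) (step (+ n) (+ k))

  embed⁰ : Permutation′ n → AffPermᵏ n 0
  embed⁰ w = record
    { perm    = embed w
    ; average = trans (displacement-embed w) (sym (ℤ.*-zeroʳ (+ n)))
    }

  x : k ℕ.≤ n → Permutation′ n → AffPermᵏ n k
  x {k} k≤n w = record
    { perm    = embed w ⁻¹ · τ k
    ; average = begin
        displacement (embed w ⁻¹ · τ k)                 ≡⟨ displacement-· (embed w ⁻¹) (τ k) ⟩
        displacement (embed w ⁻¹) + displacement (τ k)  ≡⟨ cong₂ _+_ (displacement-⁻¹ (embed w)) (displacement-τ k≤n) ⟩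
        - displacement (embed w) + + n * + k            ≡⟨ cong (λ z → - z + + n * + k) (displacement-embed w) ⟩
        0ℤ + + n * + k                                  ≡⟨ ℤ.+-identityˡ _ ⟩
        + n * + k                                       ∎
    }

  infixl 7 _·ₛ_

  _·ₛ_ : AffPermᵏ n k → Permutation′ n → AffPermᵏ n k
  _·ₛ_ {k} f v = record
    { perm    = perm f · embed v
    ; average = begin
        displacement (perm f · embed v)                 ≡⟨ displacement-· (perm f) (embed v) ⟩
        displacement (perm f) + displacement (embed v)  ≡⟨ cong₂ _+_ (average f) (displacement-embed v) ⟩
        + n * + k + 0ℤ                                  ≡⟨ ℤ.+-identityʳ _ ⟩
        + n * + k                                       ∎
    }

  swap : Fin n → ℤ → ℤ
  swap i a with + n ∣? (a - + toℕ i) | + n ∣? (a - (+ toℕ i + 1ℤ))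
  ... | yes _ | _     = a + 1ℤ
  ... | no  _ | yes _ = a - 1ℤ
  ... | no  _ | no  _ = a

  private
    n∤1 : ¬ (+ n ∣ 1ℤ)
    n∤1 n∣1 = ℕ.nonTrivial⇒≢1 {n} (ℕ.∣1⇒≡1 (∣⇒∣ᵤ n∣1))

    -- n cannot divide both a − i and a − (i + 1).
    clash : ∀ a b → + n ∣ a - b → + n ∣ a - (b + 1ℤ) → ⊥
    clash a b p q = n∤1 (subst (+ n ∣_) (i a b) (∣m∣n⇒∣m-n p q))
      where
      i : ∀ a b → (a - b) - (a - (b + 1ℤ)) ≡ 1ℤ
      i = solve-∀

  swap-lower : ∀ i a → + n ∣ a - + toℕ i → swap i a ≡ a + 1ℤ
  swap-lower i a p with + n ∣? (a - + toℕ i)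
  ... | yes _ = refl
  ... | no ¬p = contradiction p ¬p

  swap-upper : ∀ i a → + n ∣ a - (+ toℕ i + 1ℤ) → swap i a ≡ a - 1ℤ
  swap-upper i a p with + n ∣? (a - + toℕ i) | + n ∣? (a - (+ toℕ i + 1ℤ))
  ... | yes q | _     = contradiction p (clash a (+ toℕ i) q)
  ... | no  _ | yes _ = refl
  ... | no  _ | no ¬p = contradiction p ¬p

  swap-fixed : ∀ i a → ¬ (+ n ∣ a - + toℕ i) → ¬ (+ n ∣ a - (+ toℕ i + 1ℤ)) → swap i a ≡ a
  swap-fixed i a ¬p ¬q with + n ∣? (a - + toℕ i) | + n ∣? (a - (+ toℕ i + 1ℤ))
  ... | yes p | _     = contradiction p ¬p
  ... | no  _ | yes q = contradiction q ¬q
  ... | no  _ | no  _ = refl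

  swap-involutive : ∀ i a → swap i (swap i a) ≡ a
  swap-involutive i a with + n ∣? (a - + toℕ i) | + n ∣? (a - (+ toℕ i + 1ℤ))
  ... | yes p | _     = trans (swap-upper i (a + 1ℤ) (subst (+ n ∣_) (j a (+ toℕ i)) p)) (l a)
    where
    j : ∀ a b → a - b ≡ a + 1ℤ - (b + 1ℤ)
    j = solve-∀
    l : ∀ a → a + 1ℤ - 1ℤ ≡ a
    l = solve-∀
  ... | no  _ | yes q = trans (swap-lower i (a - 1ℤ) (subst (+ n ∣_) (j a (+ toℕ i)) q)) (l a)
    where
    j : ∀ a b → a - (b + 1ℤ) ≡ a - 1ℤ - b
    j = solve-∀
    l : ∀ a → a - 1ℤ + 1ℤ ≡ a
    l = solve-∀
  ... | no ¬p | no ¬q = swap-fixed i a ¬p ¬q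

  swap-periodic : ∀ i a → swap i (a + + n) ≡ swap i a + + n
  swap-periodic i a with + n ∣? (a - + toℕ i) | + n ∣? (a - (+ toℕ i + 1ℤ))
  ... | yes p | _     = trans (swap-lower i (a + + n) (up (+ toℕ i) p)) (j a (+ n) 1ℤ)
    where
    up : ∀ b → + n ∣ a - b → + n ∣ a + + n - b
    up b p = subst (+ n ∣_) (l a (+ n) b) (∣m∣n⇒∣m+n p ∣-refl)
      where
      l : ∀ a m b → a - b + m ≡ a + m - b
      l = solve-∀
    j : ∀ a m b → a + m + b ≡ a + b + m
    j = solve-∀
  ... | no  _ | yes q = trans (swap-upper i (a + + n) (up (+ toℕ i + 1ℤ) q)) (j a (+ n) -1ℤ)
    where
    up : ∀ b → + n ∣ a - b → + n ∣ a + + n - b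
    up b p = subst (+ n ∣_) (l a (+ n) b) (∣m∣n⇒∣m+n p ∣-refl)
      where
      l : ∀ a m b → a - b + m ≡ a + m - b
      l = solve-∀
    j : ∀ a m b → a + m + b ≡ a + b + m
    j = solve-∀
  ... | no ¬p | no ¬q = swap-fixed i (a + + n) (λ p → ¬p (down (+ toℕ i) p)) (λ q → ¬q (down (+ toℕ i + 1ℤ) q))
    where
    down : ∀ b → + n ∣ a + + n - b → + n ∣ a - b
    down b p = ∣m+n∣n⇒∣m (subst (+ n ∣_) (l a (+ n) b) p) ∣-refl
      where
      l : ∀ a m b → a + m - b ≡ a - b + m
      l = solve-∀

  -- The index of s ranges over {0, …, n − 1}; here Fin n is not shifted by one.
  s : Fin n → AffPerm n
  s i = record
    { bijection = mk↔ₛ′ (swap i) (swap i) (swap-involutive i) (swap-involutive i)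
    ; periodic  = swap-periodic i
    }

  product : Vec (AffPerm n) m → AffPerm n
  product = foldr _ _·_ e

  -- A word (s_{i₁}, …, s_{iₘ}) is recorded by its indices. The second component
  -- says that its length m is ℓ(f).
  IsReducedWord : AffPermᵏ n k → Vec (Fin n) m → Set
  IsReducedWord {k} {m} f is =
    product (map s is) ≈ Λ^ (- + k) · perm f × HasLength (perm f) m

  IsSubword : Vec (AffPerm n) m → Vec (Fin n) m → Set
  IsSubword = Pointwise (λ u i → u ≈ s i ⊎ u ≈ e)

  IsSubwordFor : AffPermᵏ n k → Vec (AffPerm n) m → Vec (Fin n) m → Set
  IsSubwordFor {k} f us is = IsSubword us is × product us ≈ Λ^ (- + k) · perm f

  -- w = v t with t a reflection of Sₙ and ℓ(v) < ℓ(w).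
  _⟶ᴮ_ : Permutation′ n → Permutation′ n → Set
  v ⟶ᴮ w = ∃₂ λ i j → w Perm.≈ v ∘ₚ transpose i j ×
    (∃₂ λ p q → HasLength (embed v) p × HasLength (embed w) q × p ℕ.< q)

  -- Steps up to pointwise equality are included because Star is reflexive only
  -- up to _≡_.
  _≤ᴮ_ : Permutation′ n → Permutation′ n → Set
  _≤ᴮ_ = Star (λ v w → v Perm.≈ w ⊎ v ⟶ᴮ w)

  infix 4 _⟶ᴮ_ _≤ᴮ_

-- With indices shifted to start at 0, the first block is toℕ i < k.
Grassmannian : ℕ → Permutation′ n → Set
Grassmannian k w =
  (∀ i j → i Fin.< j → toℕ j ℕ.< k → w ⟨$⟩ʳ i Fin.< w ⟨$⟩ʳ j) ×
  (∀ i j → i Fin.< j → k ℕ.≤ toℕ i → w ⟨$⟩ʳ i Fin.< w ⟨$⟩ʳ j)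

{-# OPTIONS --safe #-}

-- Every letter of a word can create at most one inversion (up to periodicity): the
-- one between the two positions that it makes adjacent. Hence a word with ℓ(f)
-- letters whose product has at least the inversions of f must use all its letters,
-- each of them at an inversion of f. This is applied twice.
--
-- For 𝐰 it shows that s₀ does not occur, since an inversion of w stays inside one
-- block {1, …, n} + qn; so every subword of 𝐰 has its product in Sₙ.
--
-- For 𝐱 let u be the product of the first ℓ(x_w) letters of 𝐮. By the previous step
-- u = Λ⁻ᵏ x_w y with y ∈ Sₙ. As w is k-Grassmannian, the values x_w(a) > x_w(b) of an
-- inversion lie in different blocks (x_w is minimal in x_w Sₙ), so y preserves this
-- inversion; hence no letter was omitted.
module Submission where

open import Defs
open import Algebra.Bundles using (AbelianGroup)
import Algebra.Properties.Group
open import Data.Bool.Base using (true; false)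
open import Data.Fin.Base as Fin using (Fin; zero; suc; toℕ; fromℕ<; punchOut)
open import Data.Fin.Permutation using (Permutation′; _⟨$⟩ʳ_)
open import Data.Fin.Properties as Fin
  using (any?; toℕ<n; toℕ-fromℕ<; injective⇒≤; punchOut-injective)
open import Data.Integer.Base as ℤ using (ℤ; +_; 0ℤ; 1ℤ; +<+; +≤+)
open import Data.Integer.Divisibility.Signed using (_∣_; divides; _∣?_)
import Data.Integer.Properties as ℤ
open import Data.Integer.Tactic.RingSolver using (solve-∀)
open import Data.Nat.Base as ℕ using (ℕ; NonTrivial; nonTrivial⇒n>1; _+_; _≤_; _<_; _<ᵇ_)
import Data.Nat.Properties as ℕ
open import Data.Product.Base using (∃; ∃₂; _×_; _,_; proj₁; proj₂)
open import Data.Sum.Base using (_⊎_; inj₁; inj₂)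
open import Data.Vec.Base using (Vec; []; _∷_; _++_; lookup; map; splitAt)
open import Data.Vec.Properties using (lookup-++-<)
open import Data.Vec.Relation.Binary.Pointwise.Inductive using ([]; _∷_; ++ˡ⁻; ++ʳ⁻)
open import Function.Bundles using (Inverse)
open import Function.Definitions using (Injective)
open import Relation.Binary.Definitions using (tri<; tri≈; tri>)
open import Relation.Binary.PropositionalEquality
open import Relation.Nullary using (yes; no; contradiction)

open Algebra.Properties.Group (AbelianGroup.group ℤ.+-0-abelianGroup)
  using () renaming (∙-cancelʳ to +-cancelʳ)

private variable
  n k m p q : ℕ

injective⇒surjective : ∀ {f : Fin m → Fin m} → Injective _≡_ _≡_ f → ∀ j → ∃ λ i → f i ≡ j
injective⇒surjective {ℕ.suc m} {f} f-inj j with any? (λ i → f i Fin.≟ j)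
... | yes hit = hit
... | no miss = contradiction (injective⇒≤ punchOut∘f-inj) ℕ.1+n≰n
  where
  j≢f : ∀ i → j ≢ f i
  j≢f i j≡fi = miss (i , sym j≡fi)
  punchOut∘f-inj : Injective _≡_ _≡_ (λ i → punchOut (j≢f i))
  punchOut∘f-inj {i} {i′} eq = f-inj (punchOut-injective (j≢f i) (j≢f i′) eq)

to-injective : ∀ (f : AffPerm n) {a b} → to f a ≡ to f b → a ≡ b
to-injective f {a} {b} eq = trans (sym (from-to f a)) (trans (cong (from f) eq) (from-to f b))

Inversion-≡ : ∀ {f : AffPerm n} {σ ρ : Inversion f} → proj₁ σ ≡ proj₁ ρ → σ ≡ ρ
Inversion-≡ {σ = _ , i₁ , i₂ , i₃ , i₄} {_ , j₁ , j₂ , j₃ , j₄} refl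
  rewrite ℤ.≤-irrelevant i₁ j₁ | ℤ.≤-irrelevant i₂ j₂ | ℤ.<-irrelevant i₃ j₃ | ℤ.<-irrelevant i₄ j₄ = refl

suc≤⇒< : ∀ {a b} → a ℤ.+ 1ℤ ℤ.≤ b → a ℤ.< b
suc≤⇒< {a} {b} h = ℤ.suc[i]≤j⇒i<j (subst (ℤ._≤ b) (ℤ.+-comm a 1ℤ) h)

<⇒suc≤ : ∀ {a b} → a ℤ.< b → a ℤ.+ 1ℤ ℤ.≤ b
<⇒suc≤ {a} {b} h = subst (ℤ._≤ b) (ℤ.+-comm 1ℤ a) (ℤ.i<j⇒suc[i]≤j h)

+1-1 : ∀ a → a ℤ.- 1ℤ ℤ.+ 1ℤ ≡ a
+1-1 = solve-∀

module _ {n : ℕ} .{{_ : NonTrivial n}} where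

  quotient-cancel-< : ∀ a b → quotient a ℤ.< quotient b → a ℤ.< b
  quotient-cancel-< a b qa<qb = begin-strict
    a                                              ≡⟨ decompose a ⟩
    pos (residue a) ℤ.+ quotient a ℤ.* + n         ≤⟨ ℤ.+-monoˡ-≤ (quotient a ℤ.* + n) (+≤+ (toℕ<n (residue a))) ⟩
    + n ℤ.+ quotient a ℤ.* + n                     ≡⟨ i (quotient a) (+ n) ⟩
    (quotient a ℤ.+ 1ℤ) ℤ.* + n                    ≤⟨ ℤ.*-monoʳ-≤-nonNeg (+ n) (<⇒suc≤ qa<qb) ⟩
    quotient b ℤ.* + n                             ≡⟨ ℤ.+-identityˡ _ ⟨
    0ℤ ℤ.+ quotient b ℤ.* + n                      <⟨ ℤ.+-monoˡ-< (quotient b ℤ.* + n) (+<+ (ℕ.s≤s ℕ.z≤n)) ⟩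
    pos (residue b) ℤ.+ quotient b ℤ.* + n         ≡⟨ decompose b ⟨
    b                                              ∎
    where
    open ℤ.≤-Reasoning
    i : ∀ q m → m ℤ.+ q ℤ.* m ≡ (q ℤ.+ 1ℤ) ℤ.* m
    i = solve-∀

  quotient-mono-≤ : ∀ a b → a ℤ.< b → quotient a ℤ.≤ quotient b
  quotient-mono-≤ a b a<b = ℤ.≮⇒≥ (λ qb<qa → ℤ.<-asym a<b (quotient-cancel-< b a qb<qa))

  quotient-block : ∀ {r} q → 1ℤ ℤ.≤ r → r ℤ.≤ + n → quotient (r ℤ.+ q ℤ.* + n) ≡ q
  quotient-block {+ ℕ.suc r} q _ (+≤+ r<n) = trans
    (cong (λ l → quotient (+ ℕ.suc l ℤ.+ q ℤ.* + n)) (sym (toℕ-fromℕ< r<n)))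
    (quotient-pos (fromℕ< r<n) q)
  quotient-block {+ ℕ.zero} _ (+≤+ ())

  quotient-first-block : ∀ {r} → 1ℤ ℤ.≤ r → r ℤ.≤ + n → quotient r ≡ 0ℤ
  quotient-first-block {r} 1≤r r≤n =
    trans (cong quotient (sym (ℤ.+-identityʳ r))) (quotient-block 0ℤ 1≤r r≤n)

  record Adjacent (i : Fin n) (a b : ℤ) : Set where
    constructor adjacent
    field
      period : ℤ
      lower  : a ≡ + toℕ i ℤ.+ period ℤ.* + n
      next   : b ≡ a ℤ.+ 1ℤ

  ∣⇒adjacent : ∀ i a → + n ∣ a ℤ.- + toℕ i → Adjacent i a (a ℤ.+ 1ℤ)
  ∣⇒adjacent i a (divides d eq) = adjacent d (trans (j a (+ toℕ i)) (cong (ℤ._+_ (+ toℕ i)) eq)) refl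
    where
    j : ∀ a i → a ≡ i ℤ.+ (a ℤ.- i)
    j = solve-∀

  swap-inversion : ∀ i a b → a ℤ.< b → swap i b ℤ.< swap i a → Adjacent i a b
  swap-inversion i a b a<b sb<sa = case
    where
    open ℤ.≤-Reasoning
    b-1≤sb : b ℤ.- 1ℤ ℤ.≤ swap i b
    b-1≤sb with + n ∣? (b ℤ.- + toℕ i) | + n ∣? (b ℤ.- (+ toℕ i ℤ.+ 1ℤ))
    ... | yes _ | _     = ℤ.+-monoʳ-≤ b ℤ.-≤+
    ... | no  _ | yes _ = ℤ.≤-refl
    ... | no  _ | no  _ = ℤ.i-j≤i b 1ℤ
    b≤sa : b ℤ.≤ swap i a
    b≤sa = begin
      b                     ≡⟨ +1-1 b ⟨
      b ℤ.- 1ℤ ℤ.+ 1ℤ       ≤⟨ ℤ.+-monoˡ-≤ 1ℤ b-1≤sb ⟩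
      swap i b ℤ.+ 1ℤ       ≤⟨ <⇒suc≤ sb<sa ⟩
      swap i a              ∎
    case : Adjacent i a b
    case with + n ∣? (a ℤ.- + toℕ i) | + n ∣? (a ℤ.- (+ toℕ i ℤ.+ 1ℤ)) | b≤sa
    ... | yes d | _     | b≤a+1 =
      subst (Adjacent i a) (ℤ.≤-antisym (<⇒suc≤ a<b) b≤a+1) (∣⇒adjacent i a d)
    ... | no  _ | yes _ | b≤a-1 = contradiction (ℤ.<-≤-trans a<b b≤a-1) (ℤ.≤⇒≯ (ℤ.i-j≤i a 1ℤ))
    ... | no  _ | no  _ | b≤a   = contradiction a<b (ℤ.≤⇒≯ b≤a)

  prefix : Vec (AffPerm n) m → Fin m → AffPerm n
  prefix (_ ∷ _)  zero    = e
  prefix (u ∷ us) (suc j) = u · prefix us j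

  Crosses : Vec (AffPerm n) m → Vec (Fin n) m → Fin m → ℤ → ℤ → Set
  Crosses us is j a b =
    lookup us j ≈ s (lookup is j) × Adjacent (lookup is j) (to (prefix us j) a) (to (prefix us j) b)

  crossing : ∀ {us : Vec (AffPerm n) m} {is} → IsSubword us is → ∀ a b → a ℤ.< b →
    to (product us) b ℤ.< to (product us) a → ∃ λ j → Crosses us is j a b
  crossing [] a b a<b b<a = contradiction b<a (ℤ.<-asym a<b)
  crossing {us = u ∷ us} (u∼i ∷ sub) a b a<b fb<fa with ℤ.<-cmp (to u a) (to u b)
  ... | tri< ua<ub _ _ with j , cr ← crossing sub (to u a) (to u b) ua<ub fb<fa = suc j , cr
  ... | tri≈ _ ua≡ub _ = contradiction (to-injective u ua≡ub) (ℤ.<⇒≢ a<b)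
  ... | tri> _ _ ub<ua with u∼i
  ...   | inj₁ u≈s = zero , u≈s , swap-inversion _ a b a<b (subst₂ ℤ._<_ (u≈s b) (u≈s a) ub<ua)
  ...   | inj₂ u≈e = contradiction (subst₂ ℤ._<_ (u≈e b) (u≈e a) ub<ua) (ℤ.<-asym a<b)

  to-translate : ∀ (f : AffPerm n) a a′ t → to f a ≡ to f a′ ℤ.+ t ℤ.* + n → a ≡ a′ ℤ.+ t ℤ.* + n
  to-translate f a a′ t eq = to-injective f (trans eq (sym (periodic-* f a′ t)))

  adjacent-unique : ∀ (f : AffPerm n) i a b a′ b′ →
    Adjacent i (to f a) (to f b) → Adjacent i (to f a′) (to f b′) →
    ∃ λ t → a ≡ a′ ℤ.+ t ℤ.* + n × b ≡ b′ ℤ.+ t ℤ.* + n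
  adjacent-unique f i a b a′ b′ (adjacent d fa fb) (adjacent d′ fa′ fb′) =
    d ℤ.- d′ , to-translate f a a′ (d ℤ.- d′) eqa , to-translate f b b′ (d ℤ.- d′) eqb
    where
    open ≡-Reasoning
    i₁ : ∀ i d d′ m → i ℤ.+ d ℤ.* m ≡ i ℤ.+ d′ ℤ.* m ℤ.+ (d ℤ.- d′) ℤ.* m
    i₁ = solve-∀
    i₂ : ∀ x y z → x ℤ.+ y ℤ.+ z ≡ x ℤ.+ z ℤ.+ y
    i₂ = solve-∀
    eqa : to f a ≡ to f a′ ℤ.+ (d ℤ.- d′) ℤ.* + n
    eqa = begin
      to f a                                                 ≡⟨ fa ⟩
      + toℕ i ℤ.+ d ℤ.* + n                                  ≡⟨ i₁ (+ toℕ i) d d′ (+ n) ⟩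
      + toℕ i ℤ.+ d′ ℤ.* + n ℤ.+ (d ℤ.- d′) ℤ.* + n          ≡⟨ cong (ℤ._+ (d ℤ.- d′) ℤ.* + n) fa′ ⟨
      to f a′ ℤ.+ (d ℤ.- d′) ℤ.* + n                         ∎
    eqb : to f b ≡ to f b′ ℤ.+ (d ℤ.- d′) ℤ.* + n
    eqb = begin
      to f b                                                 ≡⟨ fb ⟩
      to f a ℤ.+ 1ℤ                                          ≡⟨ cong (ℤ._+ 1ℤ) eqa ⟩
      to f a′ ℤ.+ (d ℤ.- d′) ℤ.* + n ℤ.+ 1ℤ                  ≡⟨ i₂ (to f a′) ((d ℤ.- d′) ℤ.* + n) 1ℤ ⟩
      to f a′ ℤ.+ 1ℤ ℤ.+ (d ℤ.- d′) ℤ.* + n                  ≡⟨ cong (ℤ._+ (d ℤ.- d′) ℤ.* + n) fb′ ⟨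
      to f b′ ℤ.+ (d ℤ.- d′) ℤ.* + n                         ∎

  -- The shift z accounts for the factor Λ⁻ᵏ in the product of a word for f.
  all-letters-cross : ∀ {us : Vec (AffPerm n) m} {is} (f : AffPerm n) (z : ℤ) →
    HasLength f m → IsSubword us is →
    (∀ a b → a ℤ.< b → to f b ℤ.< to f a → to (product us) (b ℤ.+ z) ℤ.< to (product us) (a ℤ.+ z)) →
    ∀ j → ∃₂ λ a b → a ℤ.< b × to f b ℤ.< to f a × Crosses us is j (a ℤ.+ z) (b ℤ.+ z)
  all-letters-cross {m} {us} {is} f z len sub keep j = result (injective⇒surjective index-injective j)
    where
    inv : Fin m → Inversion f
    inv = Inverse.to len
    cross : ∀ (t : Inversion f) →
      ∃ λ j → Crosses us is j (proj₁ (proj₁ t) ℤ.+ z) (proj₂ (proj₁ t) ℤ.+ z)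
    cross ((a , b) , _ , _ , a<b , fb<fa) =
      crossing sub (a ℤ.+ z) (b ℤ.+ z) (ℤ.+-monoˡ-< z a<b) (keep a b a<b fb<fa)
    move : ∀ a z c → a ℤ.+ c ℤ.+ z ≡ a ℤ.+ z ℤ.+ c
    move = solve-∀
    unshift : ∀ a a′ t → a ℤ.+ z ≡ a′ ℤ.+ z ℤ.+ t ℤ.* + n → a ≡ a′ ℤ.+ t ℤ.* + n
    unshift a a′ t eq = +-cancelʳ z a _ (trans eq (sym (move a′ z _)))
    unique : ∀ (σ ρ : Inversion f) → proj₁ (cross σ) ≡ proj₁ (cross ρ) → σ ≡ ρ
    unique σ@((a , b) , 1≤a , a≤n , _) ρ@((a′ , b′) , 1≤a′ , a′≤n , _) eq
      with cross σ | cross ρ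
    ... | j , _ , adj | j′ , _ , adj′ with refl ← eq
      with t , eqa , eqb ← adjacent-unique (prefix us j) (lookup is j) _ _ _ _ adj adj′
      = Inversion-≡ {f = f} (cong₂ _,_ (drop (unshift a a′ t eqa)) (drop (unshift b b′ t eqb)))
      where
      open ≡-Reasoning
      t≡0 : t ≡ 0ℤ
      t≡0 = begin
        t                                 ≡⟨ ℤ.+-identityˡ t ⟨
        0ℤ ℤ.+ t                          ≡⟨ cong (ℤ._+ t) (quotient-first-block 1≤a′ a′≤n) ⟨
        quotient a′ ℤ.+ t                 ≡⟨ quotient-* a′ t ⟨
        quotient (a′ ℤ.+ t ℤ.* + n)       ≡⟨ cong quotient (unshift a a′ t eqa) ⟨
        quotient a                        ≡⟨ quotient-first-block 1≤a a≤n ⟩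
        0ℤ                                ∎
      drop : ∀ {c c′} → c ≡ c′ ℤ.+ t ℤ.* + n → c ≡ c′
      drop {c′ = c′} eq = trans eq (trans (cong (λ t → c′ ℤ.+ t ℤ.* + n) t≡0) (ℤ.+-identityʳ c′))
    index : Fin m → Fin m
    index i = proj₁ (cross (inv i))
    index-injective : Injective _≡_ _≡_ index
    index-injective {i} {i′} eq = begin
      i                            ≡⟨ Inverse.strictlyInverseʳ len i ⟨
      Inverse.from len (inv i)     ≡⟨ cong (Inverse.from len) (unique (inv i) (inv i′) eq) ⟩
      Inverse.from len (inv i′)    ≡⟨ Inverse.strictlyInverseʳ len i′ ⟩
      i′                           ∎
      where open ≡-Reasoning
    result : (∃ λ i → index i ≡ j) →
      ∃₂ λ a b → a ℤ.< b × to f b ℤ.< to f a × Crosses us is j (a ℤ.+ z) (b ℤ.+ z)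
    result (i , refl) with inv i | cross (inv i)
    ... | (a , b) , _ , _ , a<b , fb<fa | j , cr = a , b , a<b , fb<fa , cr

  PreservesBlocks : AffPerm n → Set
  PreservesBlocks f = ∀ a → quotient (to f a) ≡ quotient a

  embed-preservesBlocks : ∀ w → PreservesBlocks (embed w)
  embed-preservesBlocks w a =
    trans (quotient-pos (w ⟨$⟩ʳ residue a) (quotient a ℤ.+ 0ℤ)) (ℤ.+-identityʳ (quotient a))

  adjacent-upper : ∀ {i a b} (adj : Adjacent i a b) → quotient b ≡ Adjacent.period adj
  adjacent-upper {i} {a} {b} (adjacent q lower next) = begin
    quotient b                                  ≡⟨ cong quotient next ⟩
    quotient (a ℤ.+ 1ℤ)                         ≡⟨ cong (λ c → quotient (c ℤ.+ 1ℤ)) lower ⟩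
    quotient (+ toℕ i ℤ.+ q ℤ.* + n ℤ.+ 1ℤ)     ≡⟨ cong quotient (j (+ toℕ i) (q ℤ.* + n)) ⟩
    quotient (pos i ℤ.+ q ℤ.* + n)              ≡⟨ quotient-pos i q ⟩
    q                                           ∎
    where
    open ≡-Reasoning
    j : ∀ x y → x ℤ.+ y ℤ.+ 1ℤ ≡ 1ℤ ℤ.+ x ℤ.+ y
    j = solve-∀

  adjacent-same-block : ∀ {i a b} → toℕ i ≢ 0 → Adjacent i a b → quotient a ≡ quotient b
  adjacent-same-block {i} {a} {b} i≢0 adj@(adjacent q lower _) = begin
    quotient a                              ≡⟨ cong quotient lower ⟩
    quotient (+ toℕ i ℤ.+ q ℤ.* + n)        ≡⟨ quotient-block q (+≤+ (ℕ.n≢0⇒n>0 i≢0)) (+≤+ (ℕ.<⇒≤ (toℕ<n i))) ⟩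
    q                                       ≡⟨ adjacent-upper adj ⟨
    quotient b                              ∎
    where open ≡-Reasoning

  same-block⇒≢0 : ∀ {i a b} → Adjacent i a b → quotient a ≡ quotient b → toℕ i ≢ 0
  same-block⇒≢0 {i} {a} {b} adj@(adjacent q lower _) qa≡qb i≡0 = ℤ.<⇒≢ (suc≤⇒< ℤ.≤-refl) (begin
    q ℤ.- 1ℤ
      ≡⟨ quotient-block (q ℤ.- 1ℤ) (+≤+ (ℕ.<⇒≤ (nonTrivial⇒n>1 n))) ℤ.≤-refl ⟨
    quotient (+ n ℤ.+ (q ℤ.- 1ℤ) ℤ.* + n)
      ≡⟨ cong quotient (j (+ n) q) ⟩
    quotient (0ℤ ℤ.+ q ℤ.* + n)
      ≡⟨ cong (λ l → quotient (+ l ℤ.+ q ℤ.* + n)) i≡0 ⟨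
    quotient (+ toℕ i ℤ.+ q ℤ.* + n)
      ≡⟨ cong quotient lower ⟨
    quotient a
      ≡⟨ qa≡qb ⟩
    quotient b
      ≡⟨ adjacent-upper adj ⟩
    q
      ≡⟨ +1-1 q ⟨
    q ℤ.- 1ℤ ℤ.+ 1ℤ
      ∎)
    where
    open ≡-Reasoning
    j : ∀ m q → m ℤ.+ (q ℤ.- 1ℤ) ℤ.* m ≡ 0ℤ ℤ.+ q ℤ.* m
    j = solve-∀

  s-preservesBlocks : ∀ i → toℕ i ≢ 0 → PreservesBlocks (s i)
  s-preservesBlocks i i≢0 a with + n ∣? (a ℤ.- + toℕ i) | + n ∣? (a ℤ.- (+ toℕ i ℤ.+ 1ℤ))
  ... | yes d | _     = sym (adjacent-same-block i≢0 (∣⇒adjacent i a d))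
  ... | no  _ | yes d = adjacent-same-block i≢0 (subst (Adjacent i (a ℤ.- 1ℤ)) (+1-1 a)
    (∣⇒adjacent i (a ℤ.- 1ℤ) (subst (+ n ∣_) (j a (+ toℕ i)) d)))
    where
    j : ∀ a i → a ℤ.- (i ℤ.+ 1ℤ) ≡ a ℤ.- 1ℤ ℤ.- i
    j = solve-∀
  ... | no  _ | no  _ = refl

  crosses-within-blocks⇒≢0 : ∀ (is : Vec (Fin n) m) →
    (∀ j → ∃₂ λ a b → quotient a ≡ quotient b × Crosses (map s is) is j a b) →
    ∀ j → toℕ (lookup is j) ≢ 0
  crosses-within-blocks⇒≢0 (i ∷ is) h zero with a , b , qa≡qb , _ , adj ← h zero =
    same-block⇒≢0 adj qa≡qb
  crosses-within-blocks⇒≢0 (i ∷ is) h (suc j) = crosses-within-blocks⇒≢0 is tail j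
    where
    preserved : PreservesBlocks (s i)
    preserved = s-preservesBlocks i (crosses-within-blocks⇒≢0 (i ∷ is) h zero)
    tail : ∀ j → ∃₂ λ a b → quotient a ≡ quotient b × Crosses (map s is) is j a b
    tail j with a , b , qa≡qb , cr ← h (suc j) =
      swap i a , swap i b , trans (preserved a) (trans qa≡qb (sym (preserved b))) , cr

  subword-preservesBlocks : ∀ {us : Vec (AffPerm n) m} {is} → IsSubword us is →
    (∀ j → toℕ (lookup is j) ≢ 0) → PreservesBlocks (product us)
  subword-preservesBlocks [] _ a = refl
  subword-preservesBlocks {us = u ∷ us} {i ∷ is} (u∼i ∷ sub) ≢0 a =
    trans (subword-preservesBlocks sub (λ j → ≢0 (suc j)) (to u a)) (head u∼i)
    where
    head : u ≈ s i ⊎ u ≈ e → quotient (to u a) ≡ quotient a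
    head (inj₁ u≈s) = trans (cong quotient (u≈s a)) (s-preservesBlocks i (≢0 zero) a)
    head (inj₂ u≈e) = cong quotient (u≈e a)

  full-subword : ∀ (is : Vec (Fin n) m) → IsSubword (map s is) is
  full-subword []       = []
  full-subword (_ ∷ is) = inj₁ (λ _ → refl) ∷ full-subword is

  product-++ : ∀ (us : Vec (AffPerm n) p) (vs : Vec (AffPerm n) q) →
    product (us ++ vs) ≈ product us · product vs
  product-++ []       vs a = refl
  product-++ (u ∷ us) vs a = product-++ us vs (to u a)

  Λ-shift : ∀ k (f g : AffPerm n) → f ≈ Λ^ (ℤ.- + k) · g → ∀ a → to f (a ℤ.+ + k) ≡ to g a
  Λ-shift k f g f≈ a = trans (f≈ (a ℤ.+ + k)) (cong (to g) (j a (+ k)))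
    where
    j : ∀ a k → a ℤ.+ k ℤ.+ (ℤ.- k) ≡ a
    j = solve-∀

  reduced-word-no-s₀ : ∀ w (𝐰 : Vec (Fin n) q) → IsReducedWord (embed⁰ w) 𝐰 →
    ∀ j → toℕ (lookup 𝐰 j) ≢ 0
  reduced-word-no-s₀ w 𝐰 (prod , len) = crosses-within-blocks⇒≢0 𝐰 crosses
    where
    same-block : ∀ a b → a ℤ.< b → to (embed w) b ℤ.< to (embed w) a → quotient a ≡ quotient b
    same-block a b a<b wb<wa = ℤ.≤-antisym (quotient-mono-≤ a b a<b)
      (subst₂ ℤ._≤_ (embed-preservesBlocks w b) (embed-preservesBlocks w a) (quotient-mono-≤ _ _ wb<wa))
    keep : ∀ a b → a ℤ.< b → to (embed w) b ℤ.< to (embed w) a →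
      to (product (map s 𝐰)) (b ℤ.+ 0ℤ) ℤ.< to (product (map s 𝐰)) (a ℤ.+ 0ℤ)
    keep a b _ = subst₂ ℤ._<_
      (sym (Λ-shift 0 (product (map s 𝐰)) (embed w) prod b))
      (sym (Λ-shift 0 (product (map s 𝐰)) (embed w) prod a))
    step : ∀ j → (∃₂ λ a b → a ℤ.< b × to (embed w) b ℤ.< to (embed w) a ×
        Crosses (map s 𝐰) 𝐰 j (a ℤ.+ 0ℤ) (b ℤ.+ 0ℤ)) →
      ∃₂ λ a b → quotient a ≡ quotient b × Crosses (map s 𝐰) 𝐰 j a b
    step j (a , b , a<b , wb<wa , cr) = a ℤ.+ 0ℤ , b ℤ.+ 0ℤ ,
      subst₂ (λ a b → quotient a ≡ quotient b) (sym (ℤ.+-identityʳ a)) (sym (ℤ.+-identityʳ b))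
        (same-block a b a<b wb<wa) ,
      cr
    crosses : ∀ j → ∃₂ λ a b → quotient a ≡ quotient b × Crosses (map s 𝐰) 𝐰 j a b
    crosses j = step j (all-letters-cross (embed w) 0ℤ len (full-subword 𝐰) keep j)

  χ-< : ∀ {i : Fin n} → toℕ i < k → χ k i ≡ 1ℤ
  χ-< {k} {i} i<k with toℕ i <ᵇ k | ℕ.<⇒<ᵇ i<k
  ... | true | _ = refl

  χ-≥ : ∀ {i : Fin n} → k ≤ toℕ i → χ k i ≡ 0ℤ
  χ-≥ {k} {i} k≤i with toℕ i <ᵇ k | ℕ.<ᵇ⇒< (toℕ i) k
  ... | true  | i<k = contradiction (i<k _) (ℕ.≤⇒≯ k≤i)
  ... | false | _   = refl

  residue-mono-< : ∀ {c d} → c ℤ.< d → quotient c ≡ quotient d → residue c Fin.< residue d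
  residue-mono-< {c} {d} c<d qc≡qd = ℕ.≰⇒> λ rd≤rc → ℤ.<⇒≱ c<d (begin
    d                                              ≡⟨ decompose d ⟩
    pos (residue d) ℤ.+ quotient d ℤ.* + n         ≡⟨ cong (λ q → pos (residue d) ℤ.+ q ℤ.* + n) qc≡qd ⟨
    pos (residue d) ℤ.+ quotient c ℤ.* + n         ≤⟨ ℤ.+-monoˡ-≤ (quotient c ℤ.* + n) (+≤+ (ℕ.s≤s rd≤rc)) ⟩
    pos (residue c) ℤ.+ quotient c ℤ.* + n         ≡⟨ decompose c ⟨
    c                                              ∎)
    where open ℤ.≤-Reasoning

  module _ {k : ℕ} (k≤n : k ≤ n) (w : Permutation′ n) where

    preimage : Fin n → ℤ → ℤ
    preimage r q = pos (w ⟨$⟩ʳ r) ℤ.+ (q ℤ.- χ k r) ℤ.* + n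

    from-x : ∀ c → from (perm (x k≤n w)) c ≡ preimage (residue c) (quotient c)
    from-x c = trans
      (cong₂ (λ r q → pos (w ⟨$⟩ʳ r) ℤ.+ (q ℤ.+ 0ℤ) ℤ.* + n)
        (residue-pos (residue c) (quotient c ℤ.- χ k (residue c)))
        (quotient-pos (residue c) (quotient c ℤ.- χ k (residue c))))
      (cong (λ q → pos (w ⟨$⟩ʳ residue c) ℤ.+ q ℤ.* + n)
        (ℤ.+-identityʳ (quotient c ℤ.- χ k (residue c))))

    preimage-mono-< : Grassmannian k w → ∀ r r′ q → r Fin.< r′ → preimage r q ℤ.< preimage r′ q
    preimage-mono-< (increasing₁ , increasing₂) r r′ q r<r′ with ℕ.<-≤-connex (toℕ r) k | ℕ.<-≤-connex (toℕ r′) k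
    ... | inj₁ r<k | inj₁ r′<k rewrite χ-< {i = r} r<k | χ-< {i = r′} r′<k =
      ℤ.+-monoˡ-< ((q ℤ.- 1ℤ) ℤ.* + n) (+<+ (ℕ.s≤s (increasing₁ r r′ r<r′ r′<k)))
    ... | inj₁ r<k | inj₂ k≤r′ rewrite χ-< {i = r} r<k | χ-≥ {i = r′} k≤r′ =
      quotient-cancel-< _ _ (subst₂ ℤ._<_
        (sym (quotient-pos (w ⟨$⟩ʳ r) (q ℤ.- 1ℤ))) (sym (quotient-pos (w ⟨$⟩ʳ r′) (q ℤ.- 0ℤ)))
        (ℤ.+-monoʳ-< q ℤ.-<+))
    ... | inj₂ k≤r | inj₁ r′<k = contradiction (ℕ.<-trans r<r′ r′<k) (ℕ.≤⇒≯ k≤r)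
    ... | inj₂ k≤r | inj₂ k≤r′ rewrite χ-≥ {i = r} k≤r | χ-≥ {i = r′} k≤r′ =
      ℤ.+-monoˡ-< ((q ℤ.- 0ℤ) ℤ.* + n) (+<+ (ℕ.s≤s (increasing₂ r r′ r<r′ k≤r)))

    x-inversion-between-blocks : Grassmannian k w → let f = to (perm (x k≤n w)) in
      ∀ a b → a ℤ.< b → f b ℤ.< f a → quotient (f b) ℤ.< quotient (f a)
    x-inversion-between-blocks gr a b a<b fb<fa =
      ℤ.≤∧≢⇒< (quotient-mono-≤ _ _ fb<fa) (λ qb≡qa → ℤ.<-asym a<b (b<a qb≡qa))
      where
      f : AffPerm n
      f = perm (x k≤n w)
      from-f : ∀ a → preimage (residue (to f a)) (quotient (to f a)) ≡ a
      from-f a = trans (sym (from-x (to f a))) (from-to f a)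
      b<a : quotient (to f b) ≡ quotient (to f a) → b ℤ.< a
      b<a qb≡qa = subst₂ ℤ._<_
        (from-f b) (trans (cong (preimage (residue (to f a))) qb≡qa) (from-f a))
        (preimage-mono-< gr _ _ (quotient (to f b)) (residue-mono-< fb<fa qb≡qa))

    x-part-full : Grassmannian k w → ∀ v {us : Vec (AffPerm n) p} {vs : Vec (AffPerm n) q} {𝐱 𝐰} →
      HasLength (perm (x k≤n w)) p → IsReducedWord (embed⁰ w) 𝐰 →
      IsSubword us 𝐱 → IsSubword vs 𝐰 →
      product (us ++ vs) ≈ Λ^ (ℤ.- + k) · perm (x k≤n w ·ₛ v) →
      ∀ j → lookup us j ≈ s (lookup 𝐱 j)
    x-part-full gr v {us} {vs} {𝐱} {𝐰} len red us-sub vs-sub prod j =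
      letter (all-letters-cross f (+ k) len us-sub keep j)
      where
      f : AffPerm n
      f = perm (x k≤n w)

      block : ∀ a → quotient (to (product us) (a ℤ.+ + k)) ≡ quotient (to f a)
      block a = begin
        quotient (to (product us) b)
          ≡⟨ subword-preservesBlocks vs-sub (reduced-word-no-s₀ w 𝐰 red) (to (product us) b) ⟨
        quotient (to (product vs) (to (product us) b))
          ≡⟨ cong quotient (product-++ us vs b) ⟨
        quotient (to (product (us ++ vs)) b)
          ≡⟨ cong quotient (Λ-shift k (product (us ++ vs)) (perm (x k≤n w ·ₛ v)) prod a) ⟩
        quotient (to (embed v) (to f a))
          ≡⟨ embed-preservesBlocks v (to f a) ⟩
        quotient (to f a)
          ∎
        where
        open ≡-Reasoning
        b : ℤ
        b = a ℤ.+ + k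

      keep : ∀ a b → a ℤ.< b → to f b ℤ.< to f a →
        to (product us) (b ℤ.+ + k) ℤ.< to (product us) (a ℤ.+ + k)
      keep a b a<b fb<fa = quotient-cancel-< _ _ (subst₂ ℤ._<_ (sym (block b)) (sym (block a))
        (x-inversion-between-blocks gr a b a<b fb<fa))

      letter : (∃₂ λ a b → a ℤ.< b × to f b ℤ.< to f a × Crosses us 𝐱 j (a ℤ.+ + k) (b ℤ.+ + k)) →
        lookup us j ≈ s (lookup 𝐱 j)
      letter (_ , _ , _ , _ , us≈s , _) = us≈s

lemma3p10 : ∀ {n : ℕ} .{{_ : NonTrivial n}} {k : ℕ} (k≤n : k ≤ n)
    (v w : Permutation′ n) → v ≤ᴮ w → Grassmannian k w →
    ∀ {p q : ℕ} (𝐱 : Vec (Fin n) p) (𝐰 : Vec (Fin n) q) →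
    IsReducedWord (x k≤n w) 𝐱 → IsReducedWord (embed⁰ w) 𝐰 →
    ∀ (𝐮 : Vec (AffPerm n) (p + q)) → IsSubwordFor (x k≤n w ·ₛ v) 𝐮 (𝐱 ++ 𝐰) →
    ∀ (j : Fin (p + q)) → toℕ j < p → lookup 𝐮 j ≈ s (lookup (𝐱 ++ 𝐰) j)
lemma3p10 {n} {k} k≤n v w _ gr {p} {q} 𝐱 𝐰 (_ , len) red 𝐮 (sub , prod) j j<p =
  used (splitAt p 𝐮) sub prod
  where
  open ≡-Reasoning
  used : (∃₂ λ (us : Vec (AffPerm n) p) (vs : Vec (AffPerm n) q) → 𝐮 ≡ us ++ vs) →
    IsSubword 𝐮 (𝐱 ++ 𝐰) → product 𝐮 ≈ Λ^ (ℤ.- + k) · perm (x k≤n w ·ₛ v) →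
    lookup 𝐮 j ≈ s (lookup (𝐱 ++ 𝐰) j)
  used (us , vs , refl) sub prod a = begin
    to (lookup (us ++ vs) j) a
      ≡⟨ cong (λ u → to u a) (lookup-++-< us vs j j<p) ⟩
    to (lookup us (fromℕ< j<p)) a
      ≡⟨ x-part-full k≤n w gr v len red (++ˡ⁻ us 𝐱 sub) (++ʳ⁻ us 𝐱 sub) prod (fromℕ< j<p) a ⟩
    to (s (lookup 𝐱 (fromℕ< j<p))) a
      ≡⟨ cong (λ i → to (s i) a) (lookup-++-< 𝐱 𝐰 j j<p) ⟨
    to (s (lookup (𝐱 ++ 𝐰) j)) a
      ∎
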